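{- Let $n$ and $k$ be integers with $n>k>1$, and let $B_{n-k}$ be the Boolean lattice of height $n-k$. Then $\mathrm{Poset}(\mathrm{PF}_{n,k})$ is isomorphic, as a poset, to the direct product $\mathrm{Poset}(\mathrm{PF}_{k,k})\times B_{n-k}$.
   Context: The Boolean lattice $B_m$ of height $m$ is the lattice of subsets of an $m$-element set ordered by inclusion. Write $[n]=\{1,\dots,n\}$. A parking function of length $n$ is an $n$-tuple $(a_1,\dots,a_n)$ of positive integers whose weakly increasing rearrangement $b_1\le\dots\le b_n$ satisfies $b_i\le i$ for all $i$; $\mathrm{PF}_n$ is the set of these. For $1<k\le n$, $\mathrm{PF}_{n,k}$ is the set of $a\in\mathrm{PF}_n$ such that $k$ is not an entry of $a$ but each of $k+1,\dots,n$ is an entry of $a$. $\mathrm{NC}_m$ is the lattice of noncrossing partitions of $[m]$ (partitions for which, placing $1,\dots,m$ in clockwise order on a circle, the convex hulls of the blocks are pairwise disjoint), ordered by refinement, with the finer partition being smaller. Each covering relation $\sigma<\tau$ in $\mathrm{NC}_{n+1}$ merges two blocks $B_1,B_2$ of $\sigma$ into one block $B=B_1\cup B_2$ of $\tau$; name them so that $\min B\in B_1$, and label the covering relation by the largest element of $B_1$ that is less than every element of $B_2$. Reading the labels of a maximal chain of $\mathrm{NC}_{n+1}$ from bottom to top gives a parking function of length $n$, and this is a (known) bijection from maximal chains of $\mathrm{NC}_{n+1}$ to $\mathrm{PF}_n$. $\mathrm{Poset}(\mathrm{PF}_{n,k})$ is the poset whose Hasse diagram is the union of the maximal chains of $\mathrm{NC}_{n+1}$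 corresponding to elements of $\mathrm{PF}_{n,k}$: its elements are the noncrossing partitions lying on at least one of these chains, and its order is the reflexive-transitive closure of the covering relations occurring in these chains (it need not be an induced subposet of $\mathrm{NC}_{n+1}$). -}

module Defs where

open import Data.Fin.Base using (Fin; toℕ; inject₁; suc; _<_; _≤_)
open import Data.Fin.Subset using (Subset; _∈_; _∪_)
open import Data.Nat.Base as ℕ using (ℕ)
open import Data.Product.Base using (_×_; _,_; proj₁; ∃; ∃-syntax; Σ-syntax)
open import Data.Sum.Base using (_⊎_; inj₁; inj₂)
open import Data.Vec.Functional using (Vector)
open import Data.Vec.Functional.Relation.Binary.Permutation using (_↭_)
open import Function.Base using (id; _∘_)
import Function.Bundles as Fun
open import Level using (Level; 0ℓ; _⊔_) renaming (suc to lsuc)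
open import Relation.Binary.Bundles using (Poset)
open import Relation.Binary.Construct.Closure.ReflexiveTransitive using (Star; ε; _◅_; _◅◅_)
open import Relation.Binary.Core using (Rel; _⇒_; _⇔_)
open import Relation.Binary.Morphism.Structures using (IsOrderIsomorphism)
import Relation.Binary.Properties.Poset as PosetProperties
open import Relation.Binary.PropositionalEquality.Core using (_≡_; _≢_)
open import Relation.Binary.Structures using (IsDecEquivalence)
open import Relation.Unary using (Pred)

private
  variable
    m n : ℕ
    a b ℓ₁ ℓ₂ ℓ₃ ℓ₄ : Level

-- The i-th element of Fin m, counted from zero, stands for i + 1 ∈ [m].
value : Fin m → ℕ
value i = ℕ.suc (toℕ i)

------------------------------------------------------------------------
-- Posets

infix 4 _≅_

_≅_ : Poset a ℓ₁ ℓ₂ → Poset b ℓ₃ ℓ₄ → Set _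
P ≅ Q = ∃[ f ] IsOrderIsomorphism P._≈_ Q._≈_ P._≤_ Q._≤_ f
  where
  module P = Poset P
  module Q = Poset Q

module _ (P : Poset a ℓ₁ ℓ₂) where

  private
    module P where
      open Poset P public
      open PosetProperties P public using (_<_)

  -- x lists a chain in increasing order, and every element comparable
  -- with all of the chain already lies on it.
  record IsMaximalChain {r} (x : Vector P.Carrier (ℕ.suc r)) : Set (a ⊔ ℓ₁ ⊔ ℓ₂) where
    field
      increasing : ∀ i → x (inject₁ i) P.< x (suc i)
      maximal    : ∀ z → (∀ i → (z P.≤ x i) ⊎ (x i P.≤ z)) → ∃[ i ] z P.≈ x i

------------------------------------------------------------------------
-- Parking functions

record IsParkingFunction (a : Vector ℕ n) : Set where
  field
    positive      : ∀ i → 1 ℕ.≤ a i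
    rearrangement : Vector ℕ n
    rearranges    : rearrangement ↭ a
    increasing    : ∀ {i j} → i ≤ j → rearrangement i ℕ.≤ rearrangement j
    bounded       : ∀ i → rearrangement i ℕ.≤ value i

PF : ∀ n → Pred (Vector ℕ n) 0ℓ
PF _ = IsParkingFunction

PF[_,_] : ∀ n → ℕ → Pred (Vector ℕ n) 0ℓ
PF[ n , k ] a =
    PF n a
  × (∀ i → a i ≢ k)
  × (∀ {j} → k ℕ.< j → j ℕ.≤ n → ∃[ i ] a i ≡ j)

------------------------------------------------------------------------
-- Noncrossing partitions

-- A partition of [m] is given by the relation "lies in the same block".
-- The blocks of points on a circle have pairwise disjoint convex hulls
-- exactly when no two chords with ends in different blocks cross.
record NoncrossingPartition (m : ℕ) : Set₁ where
  infix 4 _∼_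
  field
    _∼_              : Rel (Fin m) 0ℓ
    isDecEquivalence : IsDecEquivalence _∼_
    noncrossing      : ∀ {a b c d} → a < b → b < c → c < d → a ∼ c → b ∼ d → a ∼ b

  IsBlock : Pred (Subset m) 0ℓ
  IsBlock B = ∃[ x ] ∀ y → y ∈ B Fun.⇔ x ∼ y

open NoncrossingPartition using (_∼_; IsBlock)

NC : ℕ → Poset (lsuc 0ℓ) 0ℓ 0ℓ
NC m = record
  { Carrier        = NoncrossingPartition m
  ; _≈_            = λ σ τ → _∼_ σ ⇔ _∼_ τ
  ; _≤_            = λ σ τ → _∼_ σ ⇒ _∼_ τ
  ; isPartialOrder = record
    { isPreorder = record
      { isEquivalence = record
        { refl  = id , id
        ; sym   = λ (p , q) → q , p
        ; trans = λ (p , q) (p′ , q′) → (λ x → p′ (p x)) , (λ x → q (q′ x))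
        }
      ; reflexive = λ (p , _) → p
      ; trans     = λ p q x → q (p x)
      }
    ; antisym = λ p q → p , q
    }
  }

IsLeast IsGreatest : Pred (Fin m) 0ℓ → Pred (Fin m) 0ℓ
IsLeast    Q x = Q x × (∀ {y} → Q y → x ≤ y)
IsGreatest Q x = Q x × (∀ {y} → Q y → y ≤ x)

-- IsLabel σ τ l is intended for σ covered by τ; the two blocks of σ
-- that are merged in τ are then unique.
record IsLabel (σ τ : NoncrossingPartition m) (l : Fin m) : Set where
  field
    B₁ B₂    : Subset m
    block₁   : IsBlock σ B₁
    block₂   : IsBlock σ B₂
    distinct : B₁ ≢ B₂
    merged   : IsBlock τ (B₁ ∪ B₂)
    min∈B₁   : ∃[ x ] IsLeast (_∈ B₁ ∪ B₂) x × x ∈ B₁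
    label    : IsGreatest (λ x → x ∈ B₁ × (∀ {y} → y ∈ B₂ → x < y)) l

------------------------------------------------------------------------
-- The poset of a set of words

-- Every maximal chain of NC (suc n) has n + 1 elements, so that its
-- word of labels has length n.
record MaximalChainIn {n} (S : Pred (Vector ℕ n) 0ℓ) : Set₁ where
  field
    element        : Vector (NoncrossingPartition (ℕ.suc n)) (ℕ.suc n)
    isMaximalChain : IsMaximalChain (NC (ℕ.suc n)) element
    label          : Vector (Fin (ℕ.suc n)) n
    isLabel        : ∀ i → IsLabel (element (inject₁ i)) (element (suc i)) (label i)
    word∈S         : S (value ∘ label)

-- The elements are compared by their underlying partitions only.  As
-- these form a setoid, the reflexive closure has to contain its equality.
module _ {n : ℕ} (S : Pred (Vector ℕ n) 0ℓ) where

  private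
    module NCₙ = Poset (NC (ℕ.suc n))
    open MaximalChainIn

  OnChain : Pred NCₙ.Carrier (lsuc 0ℓ)
  OnChain σ = Σ[ C ∈ MaximalChainIn S ] ∃[ i ] σ NCₙ.≈ element C i

  CoverOnChain : Rel NCₙ.Carrier (lsuc 0ℓ)
  CoverOnChain σ τ = Σ[ C ∈ MaximalChainIn S ] ∃[ i ]
    (σ NCₙ.≈ element C (inject₁ i)) × (τ NCₙ.≈ element C (suc i))

  infix 4 _≼_

  _≼_ : Rel (∃ OnChain) (lsuc 0ℓ)
  _≼_ = Star λ (σ , _) (τ , _) → (σ NCₙ.≈ τ) ⊎ CoverOnChain σ τ

  ≼⇒≤ : ∀ {x y} → x ≼ y → proj₁ x NCₙ.≤ proj₁ y
  ≼⇒≤ {x} ε = NCₙ.refl {proj₁ x}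
  ≼⇒≤ (inj₁ (p , _) ◅ xs) e = ≼⇒≤ xs (p e)
  ≼⇒≤ (inj₂ (C , i , (p , _) , (_ , q)) ◅ xs) e =
    ≼⇒≤ xs (q (proj₁ (IsMaximalChain.increasing (isMaximalChain C) i) (p e)))

  wordPoset : Poset (lsuc 0ℓ) 0ℓ (lsuc 0ℓ)
  wordPoset = record
    { Carrier        = ∃ OnChain
    ; _≈_            = λ (σ , _) (τ , _) → σ NCₙ.≈ τ
    ; _≤_            = _≼_
    ; isPartialOrder = record
      { isPreorder = record
        { isEquivalence = record
          { refl  = λ {x} → NCₙ.Eq.refl {proj₁ x}
          ; sym   = λ {x} {y} → NCₙ.Eq.sym {proj₁ x} {proj₁ y}
          ; trans = λ {x} {y} {z} → NCₙ.Eq.trans {proj₁ x} {proj₁ y} {proj₁ z}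
          }
        ; reflexive = λ p → inj₁ p ◅ ε
        ; trans     = _◅◅_
        }
      ; antisym = λ p q → ≼⇒≤ p , ≼⇒≤ q
      }
    }

module Submission where

-- Restricting a partition of [n + 2] to [n + 1] and recording whether the last
-- two points lie in one block peels the factor {0, 1} off Poset(PF_{n+1,k})
-- when k ≤ n; the theorem follows by induction on n ∸ k.
--
-- In a labelled chain, call the least element of the merged block B₂ the child
-- of the step.  A child stops being a block minimum in its step, so the
-- children of the n steps are distinct and run through all points but the
-- first.  Hence the chain starts with singletons, ends with one block and is
-- maximal, and, as each label is smaller than its child, its word is
-- automatically a parking function.  For the same reason the label n + 1 can
-- only attach the last point to its predecessor: deleting that step gives a
-- chain for PF_{n,k}, and conversely such a step may be inserted anywhere.

open import Defs
open import Data.Fin.Subset.Properties using (⊆-poset)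
open import Data.Nat.Base using (ℕ; _<_; _∸_)
open import Data.Product.Relation.Binary.Pointwise.NonDependent using (×-poset)

open import Data.Bool.Base as Bool using (Bool; true; false; _∨_)
import Data.Bool.Properties as Bool
open import Data.Fin.Base as F using (Fin; zero; suc; toℕ; fromℕ; inject₁; punchIn; punchOut; pinch)
import Data.Fin.Properties as F
import Data.Fin.Permutation as Perm
open import Data.Fin.Relation.Unary.Top using (view; ‵fromℕ; ‵inject₁)
open import Data.Fin.Subset using (Subset; _∈_; _∪_; _⊆_)
open import Data.Fin.Subset.Properties using (x∈p∪q⁻; x∈p∪q⁺; out⊆; s⊆s; drop-∷-⊆)
open import Data.Nat.Base using (zero; suc; _≤_; _+_; z≤n; s≤s)
import Data.Nat.Properties as ℕ
open import Data.Product.Base using (_×_; _,_; proj₁; proj₂; ∃; ∃-syntax; Σ-syntax)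
open import Data.Sum.Base as Sum using (_⊎_; inj₁; inj₂)
open import Data.Vec.Base using ([]; _∷_; here; tabulate)
open import Data.Vec.Functional using (Vector; insertAt)
open import Data.Vec.Functional.Properties using (insertAt-lookup; insertAt-punchIn)
open import Data.Vec.Functional.Relation.Binary.Permutation using (_↭_)
open import Data.Vec.Properties using (lookup∘tabulate; []=⇒lookup; lookup⇒[]=; ∷-injectiveˡ; ∷-injectiveʳ)
open import Function.Base using (_∘_; _on_)
open import Function.Bundles using (module Equivalence; mk⇔)
open import Function.Definitions using (Injective)
open import Level using (Level; 0ℓ)
open import Relation.Binary.Bundles using (Poset)
open import Relation.Binary.Construct.Closure.ReflexiveTransitive using (ε; _◅_; _◅◅_)
open import Relation.Binary.Morphism.Structures using (IsOrderIsomorphism)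
open import Relation.Binary.Core using (_⇒_; _⇔_)
open import Relation.Binary.Definitions using (tri<; tri≈; tri>)
open import Relation.Binary.PropositionalEquality.Core using (_≡_; _≢_; refl; sym; trans; cong; cong₂; subst; subst₂)
import Relation.Binary.PropositionalEquality.Properties as ≡
import Relation.Binary.Construct.On as On
open import Relation.Binary.Construct.Intersection using (_∩_; isDecEquivalence)
open import Relation.Binary.Structures using (IsDecEquivalence)
open import Relation.Nullary using (¬_; Dec; yes; no; does; contradiction)
open import Relation.Nullary.Decidable using (dec-true; dec-false)
open import Relation.Unary using (Pred; Decidable)

private
  variable
    m n : ℕ

-- Finite sets: injections and least elements

-- If `y` were missed, `punchOut` at `y` would turn `f` into an injection into a smaller set.
injective⇒section : {f : Fin n → Fin n} → Injective _≡_ _≡_ f → ∀ y → ∃[ x ] f x ≡ y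
injective⇒section {suc n} {f} f-inj y with F.any? (λ x → f x F.≟ y)
... | yes hit  = hit
... | no  miss = contradiction
  (F.injective⇒≤ (f-inj ∘ F.punchOut-injective (≢f _) (≢f _))) ℕ.1+n≰n
  where
  ≢f : ∀ x → y ≢ f x
  ≢f x eq = miss (x , sym eq)

least : {P : Pred (Fin n) _} → Decidable P → ∃ P → ∃ (IsLeast P)
least {suc n} P? (x , px) with P? zero
... | yes p₀ = zero , p₀ , λ _ → z≤n
least {suc n} P? (zero  , px) | no ¬p₀ = contradiction px ¬p₀
least {suc n} {P} P? (suc x , px) | no ¬p₀ with y , py , y≤ ← least (P? ∘ suc) (x , px) =
  suc y , py , suc-y≤
  where
  suc-y≤ : ∀ {z} → P z → suc y F.≤ z
  suc-y≤ {zero}  p = contradiction p ¬p₀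
  suc-y≤ {suc z} p = s≤s (y≤ p)

-- Sorting and a criterion for parking functions

argmin : (w : Vector ℕ (suc n)) → ∃[ i ] ∀ j → w i ≤ w j
argmin {zero}  w = zero , λ { zero → ℕ.≤-refl }
argmin {suc n} w with i , wi≤ ← argmin (w ∘ suc) with ℕ.≤-total (w zero) (w (suc i))
... | inj₁ w₀≤ = zero  , λ { zero → ℕ.≤-refl ; (suc j) → ℕ.≤-trans w₀≤ (wi≤ j) }
... | inj₂ ≤w₀ = suc i , λ { zero → ≤w₀      ; (suc j) → wi≤ j }

Sorted : Vector ℕ n → Set
Sorted v = ∀ {i j} → i F.≤ j → v i ≤ v j

sort : (w : Vector ℕ n) → Σ[ v ∈ Vector ℕ n ] v ↭ w × Sorted v
sort {zero}  w = w , (Perm.id , λ _ → refl) , λ { {()} }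
sort {suc n} w with i , wi≤ ← argmin w with v , (π , vπ≡) , v↑ ← sort (w ∘ punchIn i) =
  v′ , (ρ , v′ρ≡) , v′↑
  where
  v′ : Vector ℕ (suc n)
  v′ zero    = w i
  v′ (suc j) = v j

  ρ : Perm.Permutation (suc n) (suc n)
  ρ = Perm.insert i zero π

  v′ρ≡ : ∀ j → v′ (ρ Perm.⟨$⟩ʳ j) ≡ w j
  v′ρ≡ j with i F.≟ j
  ... | yes refl = refl
  ... | no  i≢j  = trans (vπ≡ _) (cong w (F.punchIn-punchOut i≢j))

  wi≤v : ∀ j → w i ≤ v j
  wi≤v j = subst (w i ≤_) (trans (sym (vπ≡ _)) (cong v (Perm.inverseʳ π))) (wi≤ _)

  v′↑ : Sorted v′
  v′↑ {zero}  {zero}  _         = ℕ.≤-refl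
  v′↑ {zero}  {suc j} _         = wi≤v j
  v′↑ {suc i} {suc j} (s≤s i≤j) = v↑ i≤j

-- The positions `s j` with `j ≤ i` hold `value i` many letters that are at most `value i`, so the
-- letter at `i` in sorted order obeys the same bound.
isParkingFunction : (w : Vector ℕ n) → (∀ i → 1 ≤ w i) →
  (s : Fin n → Fin n) → Injective _≡_ _≡_ s → (∀ j → w (s j) ≤ value j) → PF n w
isParkingFunction w w≥1 s s-inj ws≤ with v , (π , vπ≡) , v↑ ← sort w = record
  { positive      = w≥1
  ; rearrangement = v
  ; rearranges    = π , vπ≡
  ; increasing    = v↑
  ; bounded       = bounded
  }
  where
  π-inj : Injective _≡_ _≡_ (π Perm.⟨$⟩ʳ_)
  π-inj eq = trans (sym (Perm.inverseˡ π)) (trans (cong (π Perm.⟨$⟩ˡ_) eq) (Perm.inverseˡ π))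

  bounded : ∀ i → v i ≤ value i
  -- Pigeonhole: an injection cannot send all positions up to `i` strictly below `i`, so some
  -- `j ≤ i` lands at or above `i` in sorted order.
  bounded i with j , j≤i , i≤πsj ← F.injective⇒existsPivot (s-inj ∘ π-inj) i = begin
    v i                      ≤⟨ v↑ i≤πsj ⟩
    v (π Perm.⟨$⟩ʳ (s j))    ≡⟨ vπ≡ (s j) ⟩
    w (s j)                  ≤⟨ ws≤ j ⟩
    value j                  ≤⟨ s≤s j≤i ⟩
    value i                  ∎
    where open ℕ.≤-Reasoning

-- Noncrossing partitions, block minima and merges

infix 4 _[_∼_] _⊑_ _≋_

_[_∼_] : NoncrossingPartition m → Fin m → Fin m → Set
σ [ x ∼ y ] = NoncrossingPartition._∼_ σ x y

_⊑_ _≋_ : NoncrossingPartition m → NoncrossingPartition m → Set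
σ ⊑ τ = NoncrossingPartition._∼_ σ ⇒ NoncrossingPartition._∼_ τ
σ ≋ τ = NoncrossingPartition._∼_ σ ⇔ NoncrossingPartition._∼_ τ

≋-refl : (σ : NoncrossingPartition m) → σ ≋ σ
≋-refl σ = (λ e → e) , (λ e → e)

≋-sym : (σ τ : NoncrossingPartition m) → σ ≋ τ → τ ≋ σ
≋-sym σ τ (p , q) = q , p

≋-trans : (ρ σ τ : NoncrossingPartition m) → ρ ≋ σ → σ ≋ τ → ρ ≋ τ
≋-trans ρ σ τ (p , q) (p′ , q′) = (λ e → p′ (p e)) , (λ e → q (q′ e))

module _ (σ : NoncrossingPartition m) where
  private module E = IsDecEquivalence (NoncrossingPartition.isDecEquivalence σ)

  ∼-refl : ∀ {x} → σ [ x ∼ x ]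
  ∼-refl = E.refl

  ∼-sym : ∀ {x y} → σ [ x ∼ y ] → σ [ y ∼ x ]
  ∼-sym = E.sym

  ∼-trans : ∀ {x y z} → σ [ x ∼ y ] → σ [ y ∼ z ] → σ [ x ∼ z ]
  ∼-trans = E.trans

  ∼-dec : ∀ x y → Dec (σ [ x ∼ y ])
  ∼-dec = E._≟_

  IsMin : Pred (Fin m) _
  IsMin x = ∀ y → σ [ x ∼ y ] → x F.≤ y

  blockMin : ∀ x → ∃[ r ] σ [ x ∼ r ] × IsMin r
  blockMin x with r , x∼r , r≤ ← least (∼-dec x) (x , ∼-refl) =
    r , x∼r , λ _ r∼y → r≤ (∼-trans x∼r r∼y)

  IsMin-unique : ∀ {x y} → IsMin x → IsMin y → σ [ x ∼ y ] → x ≡ y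
  IsMin-unique x≤ y≤ x∼y = F.≤-antisym (x≤ _ x∼y) (y≤ _ (∼-sym x∼y))

  block : Fin m → Subset m
  block x = tabulate (λ y → does (∼-dec x y))

  ∈block⁺ : ∀ {x y} → σ [ x ∼ y ] → y ∈ block x
  ∈block⁺ {x} {y} x∼y = lookup⇒[]= y (block x)
    (trans (lookup∘tabulate _ y) (dec-true (∼-dec x y) x∼y))

  ∈block⁻ : ∀ {x y} → y ∈ block x → σ [ x ∼ y ]
  ∈block⁻ {x} {y} y∈ with ∼-dec x y | trans (sym (lookup∘tabulate _ y)) ([]=⇒lookup y∈)
  ... | yes x∼y | _ = x∼y

⊑⇒IsMin : (σ τ : NoncrossingPartition m) → σ ⊑ τ → ∀ {x} → IsMin τ x → IsMin σ x
⊑⇒IsMin σ τ σ⊑τ x≤ y x∼y = x≤ y (σ⊑τ x∼y)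

-- Two blocks of `σ` inside one block of `τ` would give that block two minima. Equality of nested
-- partitions is thus reduced to a comparison of block minima.
IsMin⇒⊒ : (σ τ : NoncrossingPartition m) → σ ⊑ τ → (∀ {x} → IsMin σ x → IsMin τ x) → τ ⊑ σ
IsMin⇒⊒ σ τ σ⊑τ σ⇒τ {x} {y} x∼y
  with r , x∼r , r≤ ← blockMin σ x | s , y∼s , s≤ ← blockMin σ y
  with refl ← IsMin-unique τ (σ⇒τ r≤) (σ⇒τ s≤)
                (∼-trans τ (∼-sym τ (σ⊑τ x∼r)) (∼-trans τ x∼y (σ⊑τ y∼s)))
  = ∼-trans σ x∼r (∼-sym σ y∼s)

-- IsLabel in terms of representatives: l lies in B₁, and d is the least
-- element of B₂.
record IsMerge (σ τ : NoncrossingPartition m) (l d : Fin m) : Set where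
  field
    l<d      : l F.< d
    minimal  : IsMin σ d
    joined   : τ [ l ∼ d ]
    split    : ∀ {y} → τ [ l ∼ y ] → σ [ l ∼ y ] ⊎ σ [ d ∼ y ]
    greatest : ∀ {x} → σ [ l ∼ x ] → x F.< d → x F.≤ l

IsMerge-resp-≋ : (σ σ′ τ τ′ : NoncrossingPartition m) {l d : Fin m} →
                 σ ≋ σ′ → τ ≋ τ′ → IsMerge σ τ l d → IsMerge σ′ τ′ l d
IsMerge-resp-≋ _ _ _ _ (p , q) (p′ , q′) M = record
  { l<d      = l<d
  ; minimal  = λ y e → minimal y (q e)
  ; joined   = p′ joined
  ; split    = λ e → Sum.map p p (split (q′ e))
  ; greatest = λ e → greatest (q e)
  }
  where open IsMerge M

-- Take for `d` the least element of `B₂`: being below all of `B₂` then means being below `d`, so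
-- the two maximality conditions on `l` agree.
label⇒merge : (σ τ : NoncrossingPartition m) {l : Fin m} → IsLabel σ τ l → ∃ (IsMerge σ τ l)
label⇒merge σ τ {l} L
  with x₁ , B₁⇔ ← IsLabel.block₁ L | x₂ , B₂⇔ ← IsLabel.block₂ L | x , B⇔ ← IsLabel.merged L
  with d , x₂∼d , d≤ ← blockMin σ x₂ = d , record
  { l<d      = proj₂ (proj₁ label) d∈B₂
  ; minimal  = d≤
  ; joined   = ∼-trans τ (∼-sym τ (to (B⇔ l) (x∈p∪q⁺ (inj₁ l∈B₁)))) (to (B⇔ d) (x∈p∪q⁺ (inj₂ d∈B₂)))
  ; split    = λ {y} l∼y → Sum.map
      (λ y∈B₁ → ∼-trans σ (∼-sym σ x₁∼l) (to (B₁⇔ y) y∈B₁))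
      (λ y∈B₂ → ∼-trans σ (∼-sym σ x₂∼d) (to (B₂⇔ y) y∈B₂))
      (x∈p∪q⁻ B₁ B₂ (from (B⇔ y) (∼-trans τ (to (B⇔ l) (x∈p∪q⁺ (inj₁ l∈B₁))) l∼y)))
  ; greatest = λ {y} l∼y y<d → proj₂ label
      ( from (B₁⇔ y) (∼-trans σ x₁∼l l∼y)
      , λ {z} z∈B₂ → ℕ.<-≤-trans y<d (d≤ z (∼-trans σ (∼-sym σ x₂∼d) (to (B₂⇔ z) z∈B₂))))
  }
  where
  open IsLabel L using (B₁; B₂; label)
  open Equivalence
  l∈B₁ : l ∈ B₁
  l∈B₁ = proj₁ (proj₁ label)
  x₁∼l : σ [ x₁ ∼ l ]
  x₁∼l = to (B₁⇔ l) l∈B₁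
  d∈B₂ : d ∈ B₂
  d∈B₂ = from (B₂⇔ d) x₂∼d

merge⇒label : (σ τ : NoncrossingPartition m) → σ ⊑ τ → ∀ {l d} → IsMerge σ τ l d → IsLabel σ τ l
merge⇒label σ τ σ⊑τ {l} {d} M = record
  { B₁       = B₁
  ; B₂       = B₂
  ; block₁   = l , λ y → mk⇔ (∈block⁻ σ) (∈block⁺ σ)
  ; block₂   = d , λ y → mk⇔ (∈block⁻ σ) (∈block⁺ σ)
  -- If the blocks coincided, `l` would lie in the block of `d` but below its minimum.
  ; distinct = λ B₁≡B₂ → ℕ.<⇒≱ l<d
      (minimal l (∼-sym σ (∈block⁻ σ (subst (d ∈_) (sym B₁≡B₂) (∈block⁺ σ (∼-refl σ))))))
  ; merged   = l , λ y → mk⇔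
      (λ y∈ → Sum.[ (λ y∈B₁ → σ⊑τ (∈block⁻ σ y∈B₁))
                  , (λ y∈B₂ → ∼-trans τ joined (σ⊑τ (∈block⁻ σ y∈B₂))) ] (x∈p∪q⁻ B₁ B₂ y∈))
      (λ l∼y → x∈p∪q⁺ (Sum.map (∈block⁺ σ) (∈block⁺ σ) (split l∼y)))
  ; min∈B₁   = minimum
  ; label    = (∈block⁺ σ (∼-refl σ) , λ y∈B₂ → ℕ.<-≤-trans l<d (minimal _ (∈block⁻ σ y∈B₂)))
             , λ (x∈B₁ , x<B₂) → greatest (∈block⁻ σ x∈B₁) (x<B₂ (∈block⁺ σ (∼-refl σ)))
  }
  where
  open IsMerge M
  B₁ B₂ : Subset _
  B₁ = block σ l
  B₂ = block σ d
  minimum : ∃[ x ] IsLeast (_∈ B₁ ∪ B₂) x × x ∈ B₁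
  -- The minimum of `B₁` is at most `l`, hence smaller than `d` and than all of `B₂`.
  minimum with r , l∼r , r≤ ← blockMin σ l =
    r , ( x∈p∪q⁺ (inj₁ (∈block⁺ σ l∼r))
        , λ y∈ → Sum.[ (λ y∈B₁ → r≤ _ (∼-trans σ (∼-sym σ l∼r) (∈block⁻ σ y∈B₁)))
                     , (λ y∈B₂ → ℕ.≤-trans (r≤ _ (∼-sym σ l∼r))
                                   (ℕ.≤-trans (ℕ.<⇒≤ l<d) (minimal _ (∈block⁻ σ y∈B₂)))) ]
                     (x∈p∪q⁻ B₁ B₂ y∈))
      , ∈block⁺ σ l∼r

-- Labelled chains

⊑-monotone : (x : Vector (NoncrossingPartition m) (suc n)) → (∀ i → x (inject₁ i) ⊑ x (suc i)) →
             ∀ {i j} → i F.≤ j → x i ⊑ x j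
⊑-monotone x x↑ {zero}  {zero}  _ e = e
⊑-monotone {n = suc n} x x↑ {zero}  {suc j} _ e = ⊑-monotone (x ∘ suc) (x↑ ∘ suc) {zero} {j} z≤n (x↑ zero e)
⊑-monotone {n = suc n} x x↑ {suc i} {suc j} (s≤s i≤j) = ⊑-monotone (x ∘ suc) (x↑ ∘ suc) i≤j

suc≤inject₁ : {i j : Fin n} → i F.< j → suc i F.≤ inject₁ j
suc≤inject₁ {j = j} = subst (_ ≤_) (sym (F.toℕ-inject₁ j))

-- A discrete intermediate value principle. With `z ⊑ x i` for `P i` and `x i ⊑ z` for `Q i`, it
-- finds `z` on the chain or between two neighbours.
crossing : {P Q : Pred (Fin (suc n)) 0ℓ} → (∀ i → P i ⊎ Q i) → Q zero → P (fromℕ n) →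
           (∃[ i ] P i × Q i) ⊎ (∃[ i ] Q (inject₁ i) × P (suc i))
crossing {zero}  P⊎Q q₀ pₙ = inj₁ (zero , pₙ , q₀)
crossing {suc n} P⊎Q q₀ pₙ with P⊎Q (suc zero)
... | inj₁ p₁ = inj₂ (zero , q₀ , p₁)
... | inj₂ q₁ = Sum.map (λ (i , pq) → suc i , pq) (λ (i , qp) → suc i , qp)
                        (crossing (P⊎Q ∘ suc) q₁ pₙ)

-- Only local data are required. The ends of the chain, its maximality and the parking property
-- follow by counting children, so they need no separate check after a step is deleted or inserted.
record IsLabelledChain {n} (x : Vector (NoncrossingPartition (suc n)) (suc n))
                       (l : Vector (Fin (suc n)) n) : Set where
  field
    refines : ∀ i → x (inject₁ i) ⊑ x (suc i)
    child   : Vector (Fin (suc n)) n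
    merge   : ∀ i → IsMerge (x (inject₁ i)) (x (suc i)) (l i) (child i)

  module Merge i = IsMerge (merge i)

  monotone : ∀ {i j} → i F.≤ j → x i ⊑ x j
  monotone = ⊑-monotone x refines

  IsMin-antitone : ∀ {i j} → i F.≤ j → ∀ {y} → IsMin (x j) y → IsMin (x i) y
  IsMin-antitone i≤j = ⊑⇒IsMin (x _) (x _) (monotone i≤j)

  child-IsMin : ∀ {i s} → i F.≤ inject₁ s → IsMin (x i) (child s)
  child-IsMin i≤s = IsMin-antitone i≤s (Merge.minimal _)

  -- From level `suc s` on, the block of the child contains `l s`, which is smaller.
  child-¬IsMin : ∀ {i s} → suc s F.≤ i → ¬ IsMin (x i) (child s)
  child-¬IsMin {s = s} s<i min =
    ℕ.<⇒≱ (Merge.l<d s) (min (l s) (monotone s<i (∼-sym (x (suc s)) (Merge.joined s))))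

  child-injective : Injective _≡_ _≡_ child
  child-injective {i} {j} eq with ℕ.<-cmp (toℕ i) (toℕ j)
  ... | tri< i<j _ _ = contradiction (child-IsMin (suc≤inject₁ i<j))
    (subst (¬_ ∘ IsMin (x (suc i))) eq (child-¬IsMin ℕ.≤-refl))
  ... | tri≈ _ i≡j _ = F.toℕ-injective i≡j
  ... | tri> _ _ j<i = contradiction (child-IsMin (suc≤inject₁ j<i))
    (subst (¬_ ∘ IsMin (x (suc j))) (sym eq) (child-¬IsMin ℕ.≤-refl))

  0≢child : ∀ i → zero ≢ child i
  0≢child i eq = ℕ.n≮0 (subst (toℕ (l i) <_) (cong toℕ (sym eq)) (Merge.l<d i))

  -- As no child is `zero`, `punchOut` makes `child` an injective self-map of `Fin n`, which is
  -- onto.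
  step : ∀ (y : Fin n) → ∃[ i ] child i ≡ suc y
  step y with i , eq ← injective⇒section
                (child-injective ∘ F.punchOut-injective (0≢child _) (0≢child _)) y =
    i , trans (sym (F.punchIn-punchOut (0≢child i))) (cong suc eq)

  -- A point other than `zero` is the child of a single step `s` and a block minimum exactly up to
  -- the lower end of `s`. So step `i` costs only `child i` its minimality.
  lost : ∀ {y} i → IsMin (x (inject₁ i)) y → y ≡ child i ⊎ IsMin (x (suc i)) y
  lost {zero}  i min = inj₂ (λ _ _ → z≤n)
  lost {suc y} i min with s , eq ← step y with ℕ.<-cmp (toℕ s) (toℕ i)
  ... | tri< s<i _ _ = contradiction (subst (IsMin (x (inject₁ i))) (sym eq) min)
    (child-¬IsMin (suc≤inject₁ s<i))
  ... | tri≈ _ s≡i _ = inj₁ (trans (sym eq) (cong child (F.toℕ-injective s≡i)))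
  ... | tri> _ _ i<s = inj₂ (subst (IsMin (x (suc i))) eq (child-IsMin (suc≤inject₁ i<s)))

  first-discrete : ∀ {y z} → x zero [ y ∼ z ] → y ≡ z
  first-discrete = IsMin-unique (x zero) (isMin _) (isMin _)
    where
    isMin : ∀ y → IsMin (x zero) y
    isMin zero    = λ _ _ → z≤n
    isMin (suc y) with s , eq ← step y = subst (IsMin (x zero)) eq (child-IsMin z≤n)

  -- At the top every child has lost its minimality, so `zero` is the only block minimum left.
  last-full : ∀ y z → x (fromℕ n) [ y ∼ z ]
  last-full y z = ∼-trans (x _) (∼0 y) (∼-sym (x _) (∼0 z))
    where
    ∼0 : ∀ y → x (fromℕ n) [ y ∼ zero ]
    ∼0 y with blockMin (x (fromℕ n)) y
    ... | zero  , y∼0 , _   = y∼0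
    ... | suc r , _   , min with s , eq ← step r =
      contradiction (subst (IsMin (x (fromℕ n))) (sym eq) min) (child-¬IsMin (F.≤fromℕ (suc s)))

  isMaximalChain : IsMaximalChain (NC (suc n)) x
  isMaximalChain = record
    -- Strictness: otherwise `l i` would lie in the block of `child i` already below step `i`, where
    -- the child is minimal.
    { increasing = λ i → refines i , λ (_ , ⊒) →
        ℕ.<⇒≱ (Merge.l<d i) (Merge.minimal i (l i) (∼-sym (x _) (⊒ (Merge.joined i))))
    ; maximal    = maximal
    }
    where
    maximal : ∀ z → (∀ i → z ⊑ x i ⊎ x i ⊑ z) → ∃[ i ] z ≋ x i
    maximal z comparable with crossing {P = λ i → z ⊑ x i} {Q = λ i → x i ⊑ z} comparable
                                (λ e → subst (z [ _ ∼_]) (first-discrete e) (∼-refl z))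
                                (λ _ → last-full _ _)
    ... | inj₁ (i , z⊑ , ⊑z) = i , z⊑ , ⊑z
    -- Here `z` lies between two neighbours whose block minima differ only in `child i`. It equals
    -- the lower one if `child i` is a minimum of `z`, and the upper one otherwise.
    ... | inj₂ (i , ⊑z , z⊑) with r , d∼r , r-min ← blockMin z (child i) with r F.≟ child i
    ...   | yes refl = inject₁ i , IsMin⇒⊒ (x _) z ⊑z z-min , ⊑z
      where
      z-min : ∀ {y} → IsMin (x (inject₁ i)) y → IsMin z y
      z-min min with lost i min
      ... | inj₁ refl = r-min
      ... | inj₂ min′ = ⊑⇒IsMin z (x (suc i)) z⊑ min′
    ...   | no r≢d = suc i , z⊑ , IsMin⇒⊒ z (x (suc i)) z⊑ τ-min
      where
      τ-min : ∀ {y} → IsMin z y → IsMin (x (suc i)) y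
      τ-min min with lost i (⊑⇒IsMin (x (inject₁ i)) z ⊑z min)
      ... | inj₁ refl = contradiction (sym (IsMin-unique z min r-min d∼r)) r≢d
      ... | inj₂ min′ = min′

  -- The bound `value j` is met by the step whose child is `suc j`, because its label is smaller
  -- than `suc j`.
  isParking : PF n (value ∘ l)
  isParking = isParkingFunction (value ∘ l) (λ _ → s≤s z≤n) (proj₁ ∘ step)
    (λ {i} {j} eq → F.suc-injective (trans (sym (proj₂ (step i))) (trans (cong child eq) (proj₂ (step j)))))
    (λ j → subst (toℕ (l (proj₁ (step j))) <_) (cong toℕ (proj₂ (step j))) (Merge.l<d _))

module _ {S : Pred (Vector ℕ n) 0ℓ} where

  isLabelledChain : (C : MaximalChainIn S) → IsLabelledChain (MaximalChainIn.element C) (MaximalChainIn.label C)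
  isLabelledChain C = record
    { refines = λ i → proj₁ (IsMaximalChain.increasing isMaximalChain i)
    ; child   = λ i → proj₁ (label⇒merge (element (inject₁ i)) (element (suc i)) (isLabel i))
    ; merge   = λ i → proj₂ (label⇒merge (element (inject₁ i)) (element (suc i)) (isLabel i))
    }
    where open MaximalChainIn C

  maximalChain : {x : Vector (NoncrossingPartition (suc n)) (suc n)} {l : Vector (Fin (suc n)) n} →
                 IsLabelledChain x l → S (value ∘ l) → MaximalChainIn S
  maximalChain {x} {l} L w∈S = record
    { element        = x
    ; isMaximalChain = isMaximalChain
    ; label          = l
    ; isLabel        = λ i → merge⇒label (x (inject₁ i)) (x (suc i)) (refines i) (merge i)
    ; word∈S         = w∈S
    }
    where open IsLabelledChain L

-- Adjoining a last point

inject₁-mono-≤ : {i j : Fin n} → i F.≤ j → inject₁ i F.≤ inject₁ j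
inject₁-mono-≤ {i = i} {j} = subst₂ _≤_ (sym (F.toℕ-inject₁ i)) (sym (F.toℕ-inject₁ j))

inject₁-cancel-≤ : {i j : Fin n} → inject₁ i F.≤ inject₁ j → i F.≤ j
inject₁-cancel-≤ {i = i} {j} = subst₂ _≤_ (F.toℕ-inject₁ i) (F.toℕ-inject₁ j)

inject₁-mono-< : {i j : Fin n} → i F.< j → inject₁ i F.< inject₁ j
inject₁-mono-< {i = i} {j} = subst₂ _<_ (sym (F.toℕ-inject₁ i)) (sym (F.toℕ-inject₁ j))

inject₁-cancel-< : {i j : Fin n} → inject₁ i F.< inject₁ j → i F.< j
inject₁-cancel-< {i = i} {j} = subst₂ _<_ (F.toℕ-inject₁ i) (F.toℕ-inject₁ j)

inject₁<fromℕ : (i : Fin n) → inject₁ i F.< fromℕ n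
inject₁<fromℕ {n} i = subst (toℕ (inject₁ i) <_) (sym (F.toℕ-fromℕ n)) (F.inject₁ℕ< i)

<⇒≢fromℕ : {i j : Fin (suc n)} → i F.< j → i ≢ fromℕ n
<⇒≢fromℕ {j = j} i<j refl = ℕ.<⇒≱ i<j (F.≤fromℕ j)

≢fromℕ⇒inject₁ : {i : Fin (suc n)} → i ≢ fromℕ n → ∃[ j ] inject₁ j ≡ i
≢fromℕ⇒inject₁ {i = i} i≢ with view i
... | ‵fromℕ     = contradiction refl i≢
... | ‵inject₁ j = j , refl

-- Monotonicity is only weak, because `pinch` identifies two points. Where neighbours among `a`,
-- `b`, `c`, `d` get the same image, the equivalence laws replace the noncrossing condition.
pullback : (f : Fin m → Fin n) → (∀ {i j} → i F.≤ j → f i F.≤ f j) →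
           NoncrossingPartition n → NoncrossingPartition m
pullback f f↑ σ = record
  { _∼_              = λ x y → σ [ f x ∼ f y ]
  ; isDecEquivalence = On.isDecEquivalence f (NoncrossingPartition.isDecEquivalence σ)
  ; noncrossing      = noncrossing
  }
  where
  noncrossing : ∀ {a b c d} → a F.< b → b F.< c → c F.< d →
                σ [ f a ∼ f c ] → σ [ f b ∼ f d ] → σ [ f a ∼ f b ]
  noncrossing {a} {b} {c} {d} a<b b<c c<d a∼c b∼d
    with f a F.≟ f b | f b F.≟ f c | f c F.≟ f d
  ... | yes fa≡fb | _ | _ = subst (σ [ f a ∼_]) fa≡fb (∼-refl σ)
  ... | _ | yes fb≡fc | _ = subst (σ [ f a ∼_]) (sym fb≡fc) a∼c
  ... | _ | _ | yes fc≡fd = ∼-trans σ a∼c (∼-sym σ (subst (σ [ f b ∼_]) (sym fc≡fd) b∼d))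
  ... | no fa≢fb | no fb≢fc | no fc≢fd = NoncrossingPartition.noncrossing σ
    (F.≤∧≢⇒< (f↑ (ℕ.<⇒≤ a<b)) fa≢fb) (F.≤∧≢⇒< (f↑ (ℕ.<⇒≤ b<c)) fb≢fc)
    (F.≤∧≢⇒< (f↑ (ℕ.<⇒≤ c<d)) fc≢fd) a∼c b∼d

restrict : NoncrossingPartition (suc m) → NoncrossingPartition m
restrict = pullback inject₁ inject₁-mono-≤

-- The kernel of `b ∨ isLast x` is the total relation if `b` is true, and separates the last point
-- from the others if `b` is false.
isLast : Fin (suc n) → Bool
isLast {n} i = does (i F.≟ fromℕ n)

-- The new point joins the block of its predecessor if the bit is true, and is
-- a singleton otherwise.
extend : NoncrossingPartition (suc n) → Bool → NoncrossingPartition (suc (suc n))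
extend {n} τ b = record
  { _∼_              = NoncrossingPartition._∼_ τ′ ∩ (_≡_ on λ x → b ∨ isLast x)
  ; isDecEquivalence = isDecEquivalence (NoncrossingPartition.isDecEquivalence τ′)
      (On.isDecEquivalence _ (≡.isDecEquivalence Bool._≟_))
  ; noncrossing      = λ a<b b<c c<d (a∼c , _) (b∼d , _) →
      NoncrossingPartition.noncrossing τ′ a<b b<c c<d a∼c b∼d ,
      cong (b ∨_) (trans (dec-false (_ F.≟ _) (<⇒≢fromℕ a<b))
                    (sym (dec-false (_ F.≟ _) (<⇒≢fromℕ b<c))))
  }
  where
  τ′ : NoncrossingPartition (suc (suc n))
  τ′ = pullback (pinch (fromℕ n)) (F.pinch-mono-≤ (fromℕ n)) τ

extend-cong : (σ τ : NoncrossingPartition (suc n)) (b : Bool) → σ ≋ τ → extend σ b ≋ extend τ b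
extend-cong σ τ b (p , q) =
  (λ (e , eq) → p e , eq) , (λ (e , eq) → q e , eq)

restrict-cong : (σ τ : NoncrossingPartition (suc m)) → σ ≋ τ → restrict σ ≋ restrict τ
restrict-cong σ τ (p , q) = p , q

-- A noncrossing partition may admit neither case: the last point can share a block with earlier
-- points but not with its predecessor.
data Bit (σ : NoncrossingPartition (suc (suc n))) : Bool → Set where
  isolated : IsMin σ (fromℕ (suc n)) → Bit σ false
  attached : σ [ inject₁ (fromℕ n) ∼ fromℕ (suc n) ] → Bit σ true

Bit-resp-≋ : (σ τ : NoncrossingPartition (suc (suc n))) → σ ≋ τ → ∀ {b} → Bit σ b → Bit τ b
Bit-resp-≋ σ τ (p , q) (isolated min) = isolated (λ y e → min y (q e))
Bit-resp-≋ σ τ (p , q) (attached e)   = attached (p e)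

isolated-≁ : (σ : NoncrossingPartition (suc n)) → IsMin σ (fromℕ n) → ∀ x → ¬ σ [ inject₁ x ∼ fromℕ n ]
isolated-≁ σ min x e = ℕ.<⇒≱ (inject₁<fromℕ x) (min _ (∼-sym σ e))

bit : NoncrossingPartition (suc (suc n)) → Bool
bit {n} σ = does (∼-dec σ (inject₁ (fromℕ n)) (fromℕ (suc n)))

Bit⇒bit : (σ : NoncrossingPartition (suc (suc n))) → ∀ {b} → Bit σ b → bit σ ≡ b
Bit⇒bit σ (isolated min) = dec-false (∼-dec σ _ _) (isolated-≁ σ min _)
Bit⇒bit σ (attached e)   = dec-true (∼-dec σ _ _) e

-- An isolated last point is related to no other point, and an attached one to whatever its
-- predecessor is related to. So the restrictions decide everything, and `b ≤ c` keeps an attached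
-- point from being detached.
⊑-lift : (σ τ : NoncrossingPartition (suc (suc n))) → ∀ {b c} → Bit σ b → Bit τ c → b Bool.≤ c →
         restrict σ ⊑ restrict τ → σ ⊑ τ
⊑-lift {n} σ τ {b} {c} σb τc b≤c ⊑ = go _ _
  where
  old∼last : ∀ {b c} → Bit σ b → Bit τ c → b Bool.≤ c →
             ∀ x → σ [ inject₁ x ∼ fromℕ (suc n) ] → τ [ inject₁ x ∼ fromℕ (suc n) ]
  old∼last (isolated min) _             _        x e = contradiction e (isolated-≁ σ min x)
  old∼last (attached eσ)  (attached eτ) Bool.b≤b x e =
    ∼-trans τ (⊑ (∼-trans σ e (∼-sym σ eσ))) eτ

  go : ∀ x y → σ [ x ∼ y ] → τ [ x ∼ y ]
  go x y e with view x | view y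
  ... | ‵fromℕ     | ‵fromℕ     = ∼-refl τ
  ... | ‵inject₁ x | ‵fromℕ     = old∼last σb τc b≤c x e
  ... | ‵fromℕ     | ‵inject₁ y = ∼-sym τ (old∼last σb τc b≤c y (∼-sym σ e))
  ... | ‵inject₁ x | ‵inject₁ y = ⊑ e

≋-lift : (σ τ : NoncrossingPartition (suc (suc n))) → ∀ {b} → Bit σ b → Bit τ b →
         restrict σ ≋ restrict τ → σ ≋ τ
≋-lift σ τ σb τb (p , q) = ⊑-lift σ τ σb τb Bool.b≤b p , ⊑-lift τ σ τb σb Bool.b≤b q

pinch-fromℕ-inject₁ : (i : Fin (suc n)) → pinch (fromℕ n) (inject₁ i) ≡ i
pinch-fromℕ-inject₁ zero            = refl
pinch-fromℕ-inject₁ {suc n} (suc i) = cong suc (pinch-fromℕ-inject₁ i)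

pinch-fromℕ-fromℕ : ∀ n → pinch (fromℕ n) (fromℕ (suc n)) ≡ fromℕ n
pinch-fromℕ-fromℕ zero    = refl
pinch-fromℕ-fromℕ (suc n) = cong suc (pinch-fromℕ-fromℕ n)

isLast-inject₁ : (i : Fin n) → isLast (inject₁ i) ≡ false
isLast-inject₁ i = dec-false (inject₁ i F.≟ fromℕ _) (F.fromℕ≢inject₁ ∘ sym)

isLast-fromℕ : ∀ n → isLast (fromℕ n) ≡ true
isLast-fromℕ n = dec-true (fromℕ n F.≟ fromℕ n) refl

extend-Bit : (τ : NoncrossingPartition (suc n)) (b : Bool) → Bit (extend τ b) b
extend-Bit {n} τ false = isolated min
  where
  min : IsMin (extend τ false) (fromℕ (suc n))
  min y e with view y
  ... | ‵fromℕ     = ℕ.≤-refl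
  ... | ‵inject₁ y with () ← trans (sym (isLast-fromℕ (suc n))) (trans (proj₂ e) (isLast-inject₁ y))
extend-Bit {n} τ true  = attached
  (subst (τ [ pinch (fromℕ n) (inject₁ (fromℕ n)) ∼_])
     (trans (pinch-fromℕ-inject₁ (fromℕ n)) (sym (pinch-fromℕ-fromℕ n))) (∼-refl τ) , refl)

restrict-extend : (τ : NoncrossingPartition (suc n)) (b : Bool) → restrict (extend τ b) ≋ τ
restrict-extend τ b =
  (λ (e , _) → subst₂ (τ [_∼_]) (pinch-fromℕ-inject₁ _) (pinch-fromℕ-inject₁ _) e) ,
  (λ {x} {y} e → subst₂ (τ [_∼_]) (sym (pinch-fromℕ-inject₁ x)) (sym (pinch-fromℕ-inject₁ y)) e ,
         cong (b ∨_) (trans (isLast-inject₁ x) (sym (isLast-inject₁ y))))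

IsMin-lift : (σ : NoncrossingPartition (suc m)) → ∀ {x} → IsMin (restrict σ) x → IsMin σ (inject₁ x)
IsMin-lift σ {x} min y e with view y
... | ‵fromℕ     = F.≤fromℕ (inject₁ x)
... | ‵inject₁ y = inject₁-mono-≤ (min y e)

IsMin-restrict : (σ : NoncrossingPartition (suc m)) → ∀ {x} → IsMin σ (inject₁ x) → IsMin (restrict σ) x
IsMin-restrict σ min y e = inject₁-cancel-≤ (min (inject₁ y) e)

IsMerge-restrict : (σ τ : NoncrossingPartition (suc m)) {l d : Fin m} →
                   IsMerge σ τ (inject₁ l) (inject₁ d) → IsMerge (restrict σ) (restrict τ) l d
IsMerge-restrict σ τ M = record
  { l<d      = inject₁-cancel-< l<d
  ; minimal  = IsMin-restrict σ minimal
  ; joined   = joined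
  ; split    = split
  ; greatest = λ e x<d → inject₁-cancel-≤ (greatest e (inject₁-mono-< x<d))
  }
  where open IsMerge M

-- An isolated last point takes no part in the merge, and an attached one goes with its predecessor,
-- which settles `split` for it.
IsMerge-lift : (σ τ : NoncrossingPartition (suc (suc n))) {b : Bool} {l d : Fin (suc n)} →
               Bit σ b → Bit τ b → IsMerge (restrict σ) (restrict τ) l d →
               IsMerge σ τ (inject₁ l) (inject₁ d)
IsMerge-lift {n} σ τ {b} {l} {d} σb τb M = record
  { l<d      = inject₁-mono-< l<d
  ; minimal  = IsMin-lift σ minimal
  ; joined   = joined
  ; split    = split′ _
  ; greatest = greatest′ _
  }
  where
  open IsMerge M

  split-last : ∀ {b} → Bit σ b → Bit τ b → τ [ inject₁ l ∼ fromℕ (suc n) ] →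
               σ [ inject₁ l ∼ fromℕ (suc n) ] ⊎ σ [ inject₁ d ∼ fromℕ (suc n) ]
  split-last (isolated _)  (isolated min) e = contradiction e (isolated-≁ τ min l)
  split-last (attached eσ) (attached eτ)  e =
    Sum.map (λ e′ → ∼-trans σ e′ eσ) (λ e′ → ∼-trans σ e′ eσ) (split (∼-trans τ e (∼-sym τ eτ)))

  split′ : ∀ y → τ [ inject₁ l ∼ y ] → σ [ inject₁ l ∼ y ] ⊎ σ [ inject₁ d ∼ y ]
  split′ y e with view y
  ... | ‵fromℕ     = split-last σb τb e
  ... | ‵inject₁ y = split e

  greatest′ : ∀ x → σ [ inject₁ l ∼ x ] → x F.< inject₁ d → x F.≤ inject₁ l
  greatest′ x e x<d with view x
  ... | ‵fromℕ     = contradiction refl (<⇒≢fromℕ x<d)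
  ... | ‵inject₁ x = inject₁-mono-≤ (greatest e (inject₁-cancel-< x<d))

-- Old points keep their blocks, so the merge joins the last singleton to the block of its
-- predecessor, the largest point below it.
IsMerge-attach : (σ τ : NoncrossingPartition (suc (suc n))) → Bit σ false → Bit τ true →
                 restrict σ ≋ restrict τ → IsMerge σ τ (inject₁ (fromℕ n)) (fromℕ (suc n))
IsMerge-attach {n} σ τ (isolated min) (attached e) (_ , q) = record
  { l<d      = inject₁<fromℕ (fromℕ n)
  ; minimal  = min
  ; joined   = e
  ; split    = split _
  ; greatest = λ _ x<last → greatest (≢fromℕ⇒inject₁ (<⇒≢fromℕ x<last))
  }
  where
  split : ∀ y → τ [ inject₁ (fromℕ n) ∼ y ] → σ [ inject₁ (fromℕ n) ∼ y ] ⊎ σ [ fromℕ (suc n) ∼ y ]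
  split y e with view y
  ... | ‵fromℕ     = inj₂ (∼-refl σ)
  ... | ‵inject₁ y = inj₁ (q e)

  greatest : ∀ {x} → ∃[ y ] inject₁ y ≡ x → x F.≤ inject₁ (fromℕ n)
  greatest (y , refl) = inject₁-mono-≤ (F.≤fromℕ y)

data PunchInView (i : Fin (suc n)) : Fin (suc n) → Set where
  hole  : PunchInView i i
  other : ∀ j → PunchInView i (punchIn i j)

punchInView : (i j : Fin (suc n)) → PunchInView i j
punchInView i j with i F.≟ j
... | yes refl = hole
... | no  i≢j  = subst (PunchInView i) (F.punchIn-punchOut i≢j) (other (punchOut i≢j))

-- Deleting the step in which the last point is attached

-- Removing level `suc s` leaves the lower end of every remaining step in place, except for the step
-- right after `s`: its lower end `suc s` is replaced by `inject₁ s`.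
punchIn-suc-inject₁ : (s : Fin (suc n)) (j : Fin n) →
  inject₁ (punchIn s j) ≡ punchIn (suc s) (inject₁ j) ⊎
  (inject₁ (punchIn s j) ≡ suc s × punchIn (suc s) (inject₁ j) ≡ inject₁ s)
punchIn-suc-inject₁ zero    zero    = inj₂ (refl , refl)
punchIn-suc-inject₁ zero    (suc j) = inj₁ refl
punchIn-suc-inject₁ (suc s) zero    = inj₁ refl
punchIn-suc-inject₁ (suc s) (suc j) =
  Sum.map (cong suc) (λ (p , q) → cong suc p , cong suc q) (punchIn-suc-inject₁ s j)

module DeleteStep
  {x : Vector (NoncrossingPartition (suc (suc n))) (suc (suc n))}
  {l : Vector (Fin (suc (suc n))) (suc n)} (L : IsLabelledChain x l)
  (s : Fin (suc n)) (child≡ : IsLabelledChain.child L s ≡ fromℕ (suc n))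
  (label≡ : l s ≡ inject₁ (fromℕ n)) where

  open IsLabelledChain L

  -- The last point is the child of step `s`, so it is a block minimum up to the lower end of `s`.
  -- Afterwards it shares a block with the label of `s`, its predecessor.
  element-Bit : ∀ i → ∃ (Bit (x i))
  element-Bit i with i F.≤? inject₁ s
  ... | yes i≤s = false , isolated (subst (IsMin (x i)) child≡ (child-IsMin i≤s))
  ... | no  i≰s = true  , attached
    (monotone (subst (_< toℕ i) (F.toℕ-inject₁ s) (ℕ.≰⇒> i≰s))
      (subst₂ (x (suc s) [_∼_]) label≡ child≡ (Merge.joined s)))

  -- The only block minimum lost in step `s` is the last point, which the restriction forgets.
  same-restriction : restrict (x (inject₁ s)) ≋ restrict (x (suc s))
  same-restriction = refines s , IsMin⇒⊒ (restrict (x (inject₁ s))) (restrict (x (suc s))) (refines s) isMin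
    where
    isMin : ∀ {y} → IsMin (restrict (x (inject₁ s))) y → IsMin (restrict (x (suc s))) y
    isMin min with lost s (IsMin-lift (x (inject₁ s)) min)
    ... | inj₁ eq   = contradiction (sym (trans eq child≡)) F.fromℕ≢inject₁
    ... | inj₂ min′ = IsMin-restrict (x (suc s)) min′

  element′ : Vector (NoncrossingPartition (suc n)) (suc n)
  element′ j = restrict (x (punchIn (suc s) j))

  element′-inject₁ : ∀ j → restrict (x (inject₁ (punchIn s j))) ≋ element′ (inject₁ j)
  element′-inject₁ j with punchIn-suc-inject₁ s j
  ... | inj₁ eq      = subst (λ i → restrict (x (inject₁ (punchIn s j))) ≋ restrict (x i)) eq (≋-refl (restrict (x _)))
  ... | inj₂ (p , q) = subst₂ (λ i j → restrict (x i) ≋ restrict (x j)) (sym p) (sym q)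
                         (proj₂ same-restriction , proj₁ same-restriction)

  element′-surjective : ∀ i → ∃[ j ] restrict (x i) ≋ element′ j
  element′-surjective i with punchInView (suc s) i
  ... | other j = j , ≋-refl (element′ j)
  ... | hole    = punchOut suc-s≢s ,
    subst (λ i → restrict (x (suc s)) ≋ restrict (x i)) (sym (F.punchIn-punchOut suc-s≢s))
      (proj₂ same-restriction , proj₁ same-restriction)
    where
    suc-s≢s : suc s ≢ inject₁ s
    suc-s≢s eq = ℕ.1+n≢n (trans (cong toℕ eq) (F.toℕ-inject₁ s))

  private
    -- Away from step `s`, no child is the last point since children are distinct, and no label is
    -- since labels lie below their children. Both therefore come from the smaller point set.
    child≢last : ∀ j → child (punchIn s j) ≢ fromℕ (suc n)
    child≢last j eq = F.punchInᵢ≢i s j (child-injective (trans eq (sym child≡)))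

    old-label : ∀ j → ∃[ i ] inject₁ i ≡ l (punchIn s j)
    old-label j = ≢fromℕ⇒inject₁ (<⇒≢fromℕ (Merge.l<d (punchIn s j)))

    old-child : ∀ j → ∃[ i ] inject₁ i ≡ child (punchIn s j)
    old-child j = ≢fromℕ⇒inject₁ (child≢last j)

  label′ : Vector (Fin (suc n)) n
  label′ j = proj₁ (old-label j)

  value-label′ : ∀ j → value (label′ j) ≡ value (l (punchIn s j))
  value-label′ j = trans (cong suc (sym (F.toℕ-inject₁ (label′ j)))) (cong value (proj₂ (old-label j)))

  isLabelledChain′ : IsLabelledChain element′ label′
  isLabelledChain′ = record
    { refines = λ j e → refines (punchIn s j) (proj₂ (element′-inject₁ j) e)
    ; child   = proj₁ ∘ old-child
    ; merge   = λ j → IsMerge-resp-≋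
        (restrict (x (inject₁ (punchIn s j)))) (element′ (inject₁ j)) (element′ (suc j)) (element′ (suc j))
        (element′-inject₁ j) (≋-refl (restrict (x _)))
        (IsMerge-restrict (x (inject₁ (punchIn s j))) (x (suc (punchIn s j)))
          (subst₂ (IsMerge _ _) (sym (proj₂ (old-label j))) (sym (proj₂ (old-child j))) (merge (punchIn s j))))
    }

-- Inserting a step in which the last point is attached

-- The bit along the enlarged chain: false up to the lower end of the inserted step, true from its
-- upper end on.
after : Fin n → Fin (suc n) → Bool
after _       zero    = false
after zero    (suc j) = true
after (suc i) (suc j) = after i j

after-inject₁ : (i : Fin n) → after i (inject₁ i) ≡ false
after-inject₁ zero    = refl
after-inject₁ (suc i) = after-inject₁ i

after-suc : (i : Fin n) → after i (suc i) ≡ true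
after-suc zero    = refl
after-suc (suc i) = after-suc i

after-punchIn : (i : Fin (suc n)) (j : Fin n) →
                after i (inject₁ (punchIn i j)) ≡ after i (suc (punchIn i j))
after-punchIn zero    j       = refl
after-punchIn (suc i) zero    = refl
after-punchIn (suc i) (suc j) = after-punchIn i j

after-fromℕ : (j : Fin n) → after (fromℕ n) (suc (punchIn (fromℕ n) j)) ≡ false
after-fromℕ zero    = refl
after-fromℕ (suc j) = after-fromℕ j

pinch-inject₁ : (i : Fin n) → pinch i (inject₁ i) ≡ i
pinch-inject₁ zero    = refl
pinch-inject₁ (suc i) = cong suc (pinch-inject₁ i)

pinch-suc : (i : Fin n) → pinch i (suc i) ≡ i
pinch-suc zero    = refl
pinch-suc (suc i) = cong suc (pinch-suc i)

pinch-inject₁-punchIn : (i : Fin (suc n)) (j : Fin n) → pinch i (inject₁ (punchIn i j)) ≡ inject₁ j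
pinch-inject₁-punchIn zero    j       = refl
pinch-inject₁-punchIn (suc i) zero    = refl
pinch-inject₁-punchIn (suc i) (suc j) = cong suc (pinch-inject₁-punchIn i j)

pinch-suc-punchIn : (i : Fin (suc n)) (j : Fin n) → pinch i (suc (punchIn i j)) ≡ suc j
pinch-suc-punchIn zero    j       = refl
pinch-suc-punchIn (suc i) zero    = refl
pinch-suc-punchIn (suc i) (suc j) = cong suc (pinch-suc-punchIn i j)

module InsertStep
  {x : Vector (NoncrossingPartition (suc n)) (suc n)} {l : Vector (Fin (suc n)) n}
  (L : IsLabelledChain x l) (s : Fin (suc n)) where

  open IsLabelledChain L

  -- `pinch s` visits level `s` twice and `after s` switches the bit in between, so the two copies
  -- are the ends of the inserted step.
  element′ : Vector (NoncrossingPartition (suc (suc n))) (suc (suc n))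
  element′ j = extend (x (pinch s j)) (after s j)

  label′ : Vector (Fin (suc (suc n))) (suc n)
  label′ = insertAt (inject₁ ∘ l) s (inject₁ (fromℕ n))

  child′ : Vector (Fin (suc (suc n))) (suc n)
  child′ = insertAt (inject₁ ∘ child) s (fromℕ (suc n))

  before-hole : element′ (inject₁ s) ≡ extend (x s) false
  before-hole = cong₂ (extend ∘ x) (pinch-inject₁ s) (after-inject₁ s)

  after-hole : element′ (suc s) ≡ extend (x s) true
  after-hole = cong₂ (extend ∘ x) (pinch-suc s) (after-suc s)

  before-other : ∀ j → element′ (inject₁ (punchIn s j)) ≡ extend (x (inject₁ j)) (after s (suc (punchIn s j)))
  before-other j = cong₂ (extend ∘ x) (pinch-inject₁-punchIn s j) (after-punchIn s j)

  after-other : ∀ j → element′ (suc (punchIn s j)) ≡ extend (x (suc j)) (after s (suc (punchIn s j)))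
  after-other j = cong (λ i → extend (x i) (after s (suc (punchIn s j)))) (pinch-suc-punchIn s j)

  refines′ : ∀ j → element′ (inject₁ j) ⊑ element′ (suc j)
  refines′ j {y} {z} with punchInView s j
  ... | hole    = subst₂ _⊑_ (sym before-hole) (sym after-hole) (λ (e , _) → e , refl) {y} {z}
  ... | other i = subst₂ _⊑_ (sym (before-other i)) (sym (after-other i)) (λ (e , eq) → refines i e , eq) {y} {z}

  merge′ : ∀ j → IsMerge (element′ (inject₁ j)) (element′ (suc j)) (label′ j) (child′ j)
  merge′ j with punchInView s j
  ... | hole rewrite before-hole | after-hole
      | insertAt-lookup (inject₁ ∘ l) s (inject₁ (fromℕ n))
      | insertAt-lookup (inject₁ ∘ child) s (fromℕ (suc n)) =
    IsMerge-attach (extend (x s) false) (extend (x s) true)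
      (extend-Bit (x s) false) (extend-Bit (x s) true)
      (≋-trans (restrict (extend (x s) false)) (x s) (restrict (extend (x s) true))
        (restrict-extend (x s) false) (≋-sym (restrict (extend (x s) true)) (x s) (restrict-extend (x s) true)))
  ... | other i rewrite before-other i | after-other i
      | insertAt-punchIn (inject₁ ∘ l) s (inject₁ (fromℕ n)) i
      | insertAt-punchIn (inject₁ ∘ child) s (fromℕ (suc n)) i =
    IsMerge-lift σ τ (extend-Bit (x (inject₁ i)) b) (extend-Bit (x (suc i)) b)
      (IsMerge-resp-≋ (x (inject₁ i)) (restrict σ) (x (suc i)) (restrict τ)
        (≋-sym (restrict σ) (x (inject₁ i)) (restrict-extend (x (inject₁ i)) b))
        (≋-sym (restrict τ) (x (suc i)) (restrict-extend (x (suc i)) b)) (merge i))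
    where
    b : Bool
    b = after s (suc (punchIn s i))
    σ τ : NoncrossingPartition (suc (suc n))
    σ = extend (x (inject₁ i)) b
    τ = extend (x (suc i)) b

  isLabelledChain′ : IsLabelledChain element′ label′
  isLabelledChain′ = record { refines = refines′ ; child = child′ ; merge = merge′ }

-- A product with one more Boolean factor

∷-⊆⁺ : ∀ {b c} {p q : Subset n} → b Bool.≤ c → p ⊆ q → b ∷ p ⊆ c ∷ q
∷-⊆⁺ Bool.f≤t p⊆q = out⊆ p⊆q
∷-⊆⁺ Bool.b≤b p⊆q = s⊆s p⊆q

∷-⊆⁻ : ∀ {b c} {p q : Subset n} → b ∷ p ⊆ c ∷ q → b Bool.≤ c
∷-⊆⁻ {b = false} {false} _     = Bool.b≤b
∷-⊆⁻ {b = false} {true}  _     = Bool.f≤t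
∷-⊆⁻ {b = true}  {c}     bp⊆cq with here ← bp⊆cq here = Bool.b≤b

module _ {p₁ p₂ p₃ q₁ q₂ q₃ r₁ r₂ r₃ : Level}
  (P : Poset p₁ p₂ p₃) (Q : Poset q₁ q₂ q₃) (R : Poset r₁ r₂ r₃) where

  private
    module P = Poset P
    module Q = Poset Q
    module R = Poset R

  -- The hypotheses make `f` and `β` together an isomorphism of `P` with the product of `Q` and the
  -- two-element chain. That chain becomes the head of the subset.
  ≅-cons : (f : P.Carrier → Q.Carrier) (β : P.Carrier → Bool) →
    (∀ x y → x P.≈ y → f x Q.≈ f y × β x ≡ β y) →
    (∀ x y → x P.≤ y → f x Q.≤ f y × β x Bool.≤ β y) →
    (∀ x y → f x Q.≈ f y → β x ≡ β y → x P.≈ y) →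
    (∀ x y → f x Q.≤ f y → β x Bool.≤ β y → x P.≤ y) →
    (∀ b y → ∃[ x ] f x Q.≈ y × β x ≡ b) →
    Q ≅ ×-poset R (⊆-poset m) → P ≅ ×-poset R (⊆-poset (suc m))
  ≅-cons {m} f β cong′ mono′ injective′ cancel′ surjective′ (g , iso) = h , record
    { isOrderMonomorphism = record
      { isOrderHomomorphism = record
        { cong = λ x≈y → let (fx≈fy , βx≡βy) = cong′ _ _ x≈y ; (eq , S≡) = I.cong fx≈fy in
                   eq , cong₂ _∷_ βx≡βy S≡
        ; mono = λ x≤y → let (fx≤fy , βx≤βy) = mono′ _ _ x≤y ; (le , S⊆) = I.mono fx≤fy in
                   le , ∷-⊆⁺ βx≤βy S⊆
        }
      ; injective = λ (eq , S≡) → injective′ _ _ (I.injective (eq , ∷-injectiveʳ S≡)) (∷-injectiveˡ S≡)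
      ; cancel    = λ (le , S⊆) → cancel′ _ _ (I.cancel (le , drop-∷-⊆ S⊆)) (∷-⊆⁻ S⊆)
      }
    ; surjective = surj
    }
    where
    module I = IsOrderIsomorphism iso

    h : P.Carrier → R.Carrier × Subset (suc m)
    h x = proj₁ (g (f x)) , β x ∷ proj₂ (g (f x))

    surj : ∀ y → ∃[ x ] ∀ {z} → z P.≈ x → proj₁ (h z) R.≈ proj₁ y × proj₂ (h z) ≡ proj₂ y
    surj (r , b ∷ S) with y , gy≈ ← I.surjective (r , S) with x , fx≈y , βx≡b ← surjective′ b y =
      x , λ z≈x → let (fz≈fx , βz≡βx) = cong′ _ _ z≈x ; (eq , S≡) = gy≈ (Q.Eq.trans fz≈fx fx≈y) in
        eq , cong₂ _∷_ (trans βz≡βx βx≡b) S≡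

-- Peeling off the largest label

module _ {k n : ℕ} (k≤n : k ≤ n) where

  private
    P Q : Poset _ _ _
    P = wordPoset PF[ suc n , k ]
    Q = wordPoset PF[ n , k ]
    module P = Poset P
    module Q = Poset Q
    open MaximalChainIn

  module Restrict (C : MaximalChainIn PF[ suc n , k ]) where
    private
      L : IsLabelledChain (element C) (label C)
      L = isLabelledChain C

      open IsLabelledChain L using (child; module Merge)

      top : ∃[ s ] value (label C s) ≡ suc n
      top = proj₂ (proj₂ (word∈S C)) (s≤s k≤n) ℕ.≤-refl

    s : Fin (suc n)
    s = proj₁ top

    private
      toℕ-label : toℕ (label C s) ≡ n
      toℕ-label = ℕ.suc-injective (proj₂ top)

      -- A label of value `suc n` is the last point but one, and the child is larger.
      child≡ : child s ≡ fromℕ (suc n)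
      child≡ = F.≤-antisym (F.≤fromℕ (child s))
        (subst (_≤ toℕ (child s)) (trans (cong suc toℕ-label) (sym (F.toℕ-fromℕ (suc n)))) (Merge.l<d s))

      label≡ : label C s ≡ inject₁ (fromℕ n)
      label≡ = F.toℕ-injective
        (trans toℕ-label (sym (trans (F.toℕ-inject₁ (fromℕ n)) (F.toℕ-fromℕ n))))

    open DeleteStep L s child≡ label≡ public

    word∈PF : PF[ n , k ] (value ∘ label′)
    word∈PF = IsLabelledChain.isParking isLabelledChain′
            , (λ j eq → proj₁ (proj₂ (word∈S C)) (punchIn s j) (trans (sym (value-label′ j)) eq))
            , occurs
      where
      occurs : ∀ {j} → k < j → j ≤ n → ∃[ i ] value (label′ i) ≡ j
      occurs {j} k<j j≤n with i , eq ← proj₂ (proj₂ (word∈S C)) k<j (ℕ.m≤n⇒m≤1+n j≤n) with punchInView s i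
      ... | hole    = contradiction (trans (sym eq) (proj₂ top)) (ℕ.<⇒≢ (s≤s j≤n))
      ... | other i = i , trans (value-label′ i) eq

    chain : MaximalChainIn PF[ n , k ]
    chain = maximalChain isLabelledChain′ word∈PF

  module Insert (C : MaximalChainIn PF[ n , k ]) (s : Fin (suc n)) where
    open InsertStep (isLabelledChain C) s public

    private
      value-hole : value (label′ s) ≡ suc n
      value-hole = cong suc (trans (cong toℕ (insertAt-lookup (inject₁ ∘ label C) s _))
        (trans (F.toℕ-inject₁ (fromℕ n)) (F.toℕ-fromℕ n)))

      value-other : ∀ j → value (label′ (punchIn s j)) ≡ value (label C j)
      value-other j = cong suc (trans (cong toℕ (insertAt-punchIn (inject₁ ∘ label C) s _ j))
        (F.toℕ-inject₁ (label C j)))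

    word∈PF : PF[ suc n , k ] (value ∘ label′)
    word∈PF = IsLabelledChain.isParking isLabelledChain′ , avoids , occurs
      where
      avoids : ∀ i → value (label′ i) ≢ k
      avoids i eq with punchInView s i
      -- The inserted letter `suc n` exceeds `k`.
      ... | hole    = ℕ.<⇒≢ (s≤s k≤n) (trans (sym eq) value-hole)
      ... | other j = proj₁ (proj₂ (word∈S C)) j (trans (sym (value-other j)) eq)

      occurs : ∀ {j} → k < j → j ≤ suc n → ∃[ i ] value (label′ i) ≡ j
      occurs k<j j≤1+n with ℕ.m≤n⇒m<n∨m≡n j≤1+n
      ... | inj₂ refl      = s , value-hole
      ... | inj₁ (s≤s j≤n) with i , eq ← proj₂ (proj₂ (word∈S C)) k<j j≤n = punchIn s i , trans (value-other i) eq

    chain : MaximalChainIn PF[ suc n , k ]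
    chain = maximalChain isLabelledChain′ word∈PF

  lower : P.Carrier → Q.Carrier
  lower (σ , σ∈) = restrict σ , restrict-OnChain σ∈
    where
    restrict-OnChain : OnChain PF[ suc n , k ] σ → OnChain PF[ n , k ] (restrict σ)
    restrict-OnChain (C , i , σ≋) with j , eq ← Restrict.element′-surjective C i =
      Restrict.chain C , j ,
      ≋-trans (restrict σ) (restrict (element C i)) (Restrict.element′ C j) (restrict-cong σ (element C i) σ≋) eq

  -- The order is generated by covers on chains, so each cover needs an image: the deleted step
  -- becomes an equality, any other step survives in the shortened chain.
  lower-mono : ∀ x y → x P.≤ y → lower x Q.≤ lower y
  lower-mono x .x ε = ε
  lower-mono x z  (_◅_ {j = y} x≤y y≤z) =
    Sum.[ (λ x≈y → inj₁ (restrict-cong (proj₁ x) (proj₁ y) x≈y))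
        , cover (proj₁ x) (proj₁ y) ] x≤y ◅ lower-mono y z y≤z
    where
    cover : ∀ σ τ → CoverOnChain PF[ suc n , k ] σ τ →
            restrict σ ≋ restrict τ ⊎ CoverOnChain PF[ n , k ] (restrict σ) (restrict τ)
    cover σ τ (C , i , σ≋ , τ≋) with punchInView (Restrict.s C) i
    ... | hole    = inj₁ (≋-trans (restrict σ) (restrict x₀) (restrict τ) (restrict-cong σ x₀ σ≋)
                      (≋-trans (restrict x₀) (restrict x₁) (restrict τ) (Restrict.same-restriction C)
                        (restrict-cong x₁ τ (≋-sym τ x₁ τ≋))))
      where
      x₀ x₁ : NoncrossingPartition (suc (suc n))
      x₀ = element C (inject₁ (Restrict.s C))
      x₁ = element C (suc (Restrict.s C))
    ... | other j = inj₂ (Restrict.chain C , j ,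
      ≋-trans (restrict σ) (restrict x₀) (Restrict.element′ C (inject₁ j))
        (restrict-cong σ x₀ σ≋) (Restrict.element′-inject₁ C j) ,
      restrict-cong τ (element C (suc (punchIn (Restrict.s C) j))) τ≋)
      where
      x₀ : NoncrossingPartition (suc (suc n))
      x₀ = element C (inject₁ (punchIn (Restrict.s C) j))

  -- Lying on a chain for `PF[ suc n , k ]` guarantees that the last point is either isolated or
  -- attached to its predecessor.
  carrier-Bit : (x : P.Carrier) → Bit (proj₁ x) (bit (proj₁ x))
  carrier-Bit (σ , C , i , σ≋) with b , βᵢ ← Restrict.element-Bit C i
    with β ← Bit-resp-≋ (element C i) σ (≋-sym σ (element C i) σ≋) βᵢ =
    subst (Bit σ) (sym (Bit⇒bit σ β)) β

  -- The new step is inserted at the level of `τ` itself, so that both extensions of `τ` lie on one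
  -- chain, as the two ends of that step.
  raise : Bool → Q.Carrier → P.Carrier
  raise b (τ , C , i , τ≋) = extend τ b , extend-OnChain b
    where
    extend-OnChain : ∀ b → OnChain PF[ suc n , k ] (extend τ b)
    extend-OnChain false = Insert.chain C i , inject₁ i ,
      subst (extend τ false ≋_) (sym (Insert.before-hole C i)) (extend-cong τ (element C i) false τ≋)
    extend-OnChain true  = Insert.chain C i , suc i ,
      subst (extend τ true ≋_) (sym (Insert.after-hole C i)) (extend-cong τ (element C i) true τ≋)

  raise-mono : ∀ b x y → x Q.≤ y → raise b x P.≤ raise b y
  raise-mono b x .x ε = ε
  raise-mono b x z  (_◅_ {j = y} x≤y y≤z) =
    Sum.map (extend-cong (proj₁ x) (proj₁ y) b) (cover b (proj₁ x) (proj₁ y)) x≤y ◅ raise-mono b y z y≤z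
    where
    coverAt : ∀ b s σ τ (C : MaximalChainIn PF[ n , k ]) i → after s (suc (punchIn s i)) ≡ b →
              σ ≋ element C (inject₁ i) → τ ≋ element C (suc i) →
              CoverOnChain PF[ suc n , k ] (extend σ b) (extend τ b)
    coverAt b s σ τ C i refl σ≋ τ≋ = Insert.chain C s , punchIn s i ,
      subst (extend σ b ≋_) (sym (Insert.before-other C s i)) (extend-cong σ (element C (inject₁ i)) b σ≋) ,
      subst (extend τ b ≋_) (sym (Insert.after-other C s i)) (extend-cong τ (element C (suc i)) b τ≋)

    cover : ∀ b σ τ → CoverOnChain PF[ n , k ] σ τ → CoverOnChain PF[ suc n , k ] (extend σ b) (extend τ b)
    -- Attaching the last point at the very end leaves it isolated throughout the old steps;
    -- attaching it at the very beginning keeps it attached throughout.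
    cover false σ τ (C , i , σ≋ , τ≋) = coverAt false (fromℕ n) σ τ C i (after-fromℕ i) σ≋ τ≋
    cover true  σ τ (C , i , σ≋ , τ≋) = coverAt true zero σ τ C i refl σ≋ τ≋

  raise-switch : ∀ x → raise false x P.≤ raise true x
  raise-switch x@(τ , C , i , τ≋) = inj₂ (Insert.chain C i , i ,
    proj₂ (proj₂ (proj₂ (raise false x))) , proj₂ (proj₂ (proj₂ (raise true x)))) ◅ ε

  raise-mono₂ : ∀ {b c} x y → b Bool.≤ c → x Q.≤ y → raise b x P.≤ raise c y
  raise-mono₂     x y Bool.f≤t x≤y = raise-mono false x y x≤y ◅◅ raise-switch y
  raise-mono₂ {b} x y Bool.b≤b x≤y = raise-mono b x y x≤y

  raise-Bit : ∀ b x → Bit (proj₁ (raise b x)) b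
  raise-Bit b (τ , _) = extend-Bit τ b

  lower-raise : ∀ b x → lower (raise b x) Q.≈ x
  lower-raise b (τ , _) = restrict-extend τ b

  bitOf : P.Carrier → Bool
  bitOf (σ , _) = bit σ

  -- Refinement is enough here: coarsening never separates the last point from its predecessor.
  bitOf-mono : ∀ x y → x P.≤ y → bitOf x Bool.≤ bitOf y
  bitOf-mono x y x≤y = go (proj₁ x) (proj₁ y) (carrier-Bit x) (carrier-Bit y) (≼⇒≤ PF[ suc n , k ] {x} {y} x≤y)
    where
    go : ∀ {b c} (σ τ : NoncrossingPartition (suc (suc n))) → Bit σ b → Bit τ c → σ ⊑ τ → b Bool.≤ c
    go σ τ (isolated _) (isolated _)   _   = Bool.b≤b
    go σ τ (isolated _) (attached _)   _   = Bool.f≤t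
    go σ τ (attached _) (attached _)   _   = Bool.b≤b
    go σ τ (attached e) (isolated min) σ⊑τ = contradiction (σ⊑τ e) (isolated-≁ τ min _)

  bitOf-cong : ∀ x y → x P.≈ y → bitOf x ≡ bitOf y
  bitOf-cong x y x≈y =
    Bit⇒bit (proj₁ x) (Bit-resp-≋ (proj₁ y) (proj₁ x) (≋-sym (proj₁ x) (proj₁ y) x≈y) (carrier-Bit y))

  ≈-cancel : ∀ x y → lower x Q.≈ lower y → bitOf x ≡ bitOf y → x P.≈ y
  ≈-cancel x y eq bit≡ = ≋-lift (proj₁ x) (proj₁ y) (carrier-Bit x)
    (subst (Bit (proj₁ y)) (sym bit≡) (carrier-Bit y)) eq

  raise-lower : ∀ x → raise (bitOf x) (lower x) P.≈ x
  raise-lower x = ≋-lift (proj₁ (raise (bitOf x) (lower x))) (proj₁ x)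
    (raise-Bit (bitOf x) (lower x)) (carrier-Bit x) (lower-raise (bitOf x) (lower x))

  -- The order need not be induced from refinement, so a path of covers has to be built: the path
  -- below is lifted at the bit of `x`, followed by a switch of the bit if `y` requires it.
  ≤-cancel : ∀ x y → lower x Q.≤ lower y → bitOf x Bool.≤ bitOf y → x P.≤ y
  ≤-cancel x y x≤y bit≤ =
    inj₁ (≋-sym (proj₁ (raise (bitOf x) (lower x))) (proj₁ x) (raise-lower x)) ◅
    (raise-mono₂ (lower x) (lower y) bit≤ x≤y ◅◅ (inj₁ (raise-lower y) ◅ ε))

  wordPoset-≅-suc : {r₁ r₂ r₃ : Level} (R : Poset r₁ r₂ r₃) →
    Q ≅ ×-poset R (⊆-poset m) → P ≅ ×-poset R (⊆-poset (suc m))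
  wordPoset-≅-suc R = ≅-cons P Q R lower bitOf
    (λ x y x≈y → restrict-cong (proj₁ x) (proj₁ y) x≈y , bitOf-cong x y x≈y)
    (λ x y x≤y → lower-mono x y x≤y , bitOf-mono x y x≤y)
    ≈-cancel ≤-cancel
    (λ b y → raise b y , lower-raise b y , Bit⇒bit (proj₁ (raise b y)) (raise-Bit b y))

-- Induction on the height: each letter above `k` contributes one two-element factor, and the base
-- case is a product with a one-point lattice.
wordPoset-≅ : ∀ m k → wordPoset PF[ m + k , k ] ≅ ×-poset (wordPoset PF[ k , k ]) (⊆-poset m)
wordPoset-≅ zero    k = (_, []) , record
  { isOrderMonomorphism = record
    { isOrderHomomorphism = record { cong = _, refl ; mono = _, λ p → p }
    ; injective           = proj₁
    ; cancel              = proj₁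
    }
  ; surjective = λ { (x , []) → x , (_, refl) }
  }
wordPoset-≅ (suc m) k = wordPoset-≅-suc (ℕ.m≤n+m k m) (wordPoset PF[ k , k ]) (wordPoset-≅ m k)

theorem2p5 : (n k : ℕ) → 1 < k → k < n →
    wordPoset PF[ n , k ] ≅ ×-poset (wordPoset PF[ k , k ]) (⊆-poset (n ∸ k))
theorem2p5 n k _ k<n =
  subst (λ i → wordPoset PF[ i , k ] ≅ ×-poset (wordPoset PF[ k , k ]) (⊆-poset (n ∸ k)))
    (ℕ.m∸n+n≡m (ℕ.<⇒≤ k<n)) (wordPoset-≅ (n ∸ k) k)
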